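{- Let $n\ge a+b$, and let $\mathcal{A}\subset\binom{[n]}{a}$ and $\mathcal{B}\subset\binom{[n]}{b}$ be cross-intersecting. Let $(U,V)$ satisfy property $\mathbf{Q}$ for the pair $(\mathcal{A},\mathcal{B})$. Then $S_{U,V}(\mathcal{A})$ and $S_{U,V}(\mathcal{B})$ are also cross-intersecting.
   Context: $[n]=\{1,\dots,n\}$; $\binom{[n]}{k}$ is the family of all $k$-subsets of $[n]$. Families $\mathcal{F},\mathcal{G}$ are cross-intersecting if $F\cap G\ne\emptyset$ for all $F\in\mathcal{F}$, $G\in\mathcal{G}$. Lexicographic order: for $A,B\subset[n]$ write $A\prec B$ if either $B\subset A$ or $\min(A\setminus B)<\min(B\setminus A)$. For a $k$-set $S\subset[n]$, $i_{\mathrm{lex}}(S)$ is the position of $S$ in the lexicographic order on $\binom{[n]}{k}$. Shift: for disjoint sets $U,V$ with $|U|=|V|$, put $S_{U,V}(F)=(F\setminus V)\cup U$ if $F\cap(U\cup V)=V$, and $S_{U,V}(F)=F$ otherwise; for a family, $S_{U,V}(\mathcal{F})=\{S_{U,V}(F):F\in\mathcal{F}\}\cup\{F\in\mathcal{F}:S_{U,V}(F)\in\mathcal{F}\}$. Property $\mathbf{Q}$: let $U,V\subset[n]$ with $U\cap V=\emptyset$, $|U|=|V|$ and $U\prec V$. The pair $(U,V)$ satisfies $\mathbf{Q}$ for a family $\mathcal{F}\subset\binom{[n]}{k}$ if $\sum_{S\in S_{U,V}(\mathcal{F})}i_{\mathrm{lex}}(S)<\sum_{S\in\mathcal{F}}i_{\mathrm{lex}}(S)$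 and for every $V'\subsetneq V$ there exists $U'\subsetneq U$ such that $U'\prec V'$, $|U'|=|V'|$ and $S_{U',V'}(\mathcal{F})=\mathcal{F}$. The pair $(U,V)$ satisfies $\mathbf{Q}$ for a pair of families $(\mathcal{A},\mathcal{B})$ if it satisfies $\mathbf{Q}$ for at least one of $\mathcal{A}$ and $\mathcal{B}$. -}

module Defs where

open import Data.Bool.Properties using () renaming (_≟_ to _≟ᵇ_)
open import Data.Fin using (Fin; _≤_; _<_; _≤?_; _<?_)
open import Data.Fin.Properties using (any?)
open import Data.Fin.Subset using (Subset; inside; outside; _∈_; _⊆_; _⊂_; _∩_; _∪_; _─_; ∣_∣; Empty; Nonempty; Lift)
open import Data.Fin.Subset.Properties using (_∈?_; _⊆?_; Lift?; anySubset?)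
open import Data.List using (List; []; _∷_; _++_; map; filter; length)
open import Data.Nat using (ℕ; zero; suc) renaming (_<_ to _<ℕ_)
open import Data.Nat.ListAction using (sum)
open import Data.Nat.Properties using () renaming (_≟_ to _≟ℕ_)
open import Data.Product using (∃; ∃₂; _×_)
open import Data.Sum using (_⊎_)
import Data.Vec as Vec
open import Data.Vec.Properties using (≡-dec)
open import Level using (0ℓ)
open import Relation.Binary using (DecidableEquality) renaming (Decidable to Decidable₂)
open import Relation.Binary.PropositionalEquality using (_≡_)
open import Relation.Nullary using (yes; no)
open import Relation.Nullary.Decidable using (_×-dec_; _⊎-dec_)
open import Relation.Unary using (Pred; Decidable; _≐_)

private
  variable
    n : ℕ

-- The ground set [n] = {1,…,n} is Fin n, with i : Fin n standing for i + 1.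

_≟ˢ_ : DecidableEquality (Subset n)
_≟ˢ_ = ≡-dec _≟ᵇ_

subsets : ∀ n → List (Subset n)
subsets zero    = Vec.[] ∷ []
subsets (suc n) = map (inside Vec.∷_) (subsets n) ++ map (outside Vec.∷_) (subsets n)

IsMin : Fin n → Subset n → Set
IsMin x p = x ∈ p × Lift (x ≤_) p

isMin? : (x : Fin n) → Decidable (IsMin x)
isMin? x p = (x ∈? p) ×-dec Lift? (x ≤?_) p

-- If A ⊊ B then min (A ∖ B) does not exist and A ≺ B fails; inclusion is
-- non-strict, so ≺ is reflexive.
infix 4 _≺_ _≺?_

_≺_ : Subset n → Subset n → Set
A ≺ B = B ⊆ A ⊎ (∃₂ λ x y → IsMin x (A ─ B) × IsMin y (B ─ A) × x < y)

_≺?_ : Decidable₂ (_≺_ {n})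
A ≺? B = (B ⊆? A) ⊎-dec any? λ x → any? λ y →
  isMin? x (A ─ B) ×-dec isMin? y (B ─ A) ×-dec (x <? y)

-- The 1-based position of S among the sets of the same size: since ≺ is a
-- reflexive total order on them, it is the number of those T with T ≺ S.
iLex : Subset n → ℕ
iLex {n} S = length (filter (λ T → (∣ T ∣ ≟ℕ ∣ S ∣) ×-dec (T ≺? S)) (subsets n))

-- Decidability of membership is automatic classically; it is what makes sums
-- over a family computable.
record Family (n : ℕ) : Set₁ where
  field
    Member  : Pred (Subset n) 0ℓ
    member? : Decidable Member

open Family public

infix 4 _∈ᶠ_ _≈ᶠ_

_∈ᶠ_ : Subset n → Family n → Set
S ∈ᶠ F = Member F S

_≈ᶠ_ : Family n → Family n → Set
F ≈ᶠ G = Member F ≐ Member G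

Uniform : ℕ → Family n → Set
Uniform k F = ∀ {S} → S ∈ᶠ F → ∣ S ∣ ≡ k

CrossIntersecting : Family n → Family n → Set
CrossIntersecting F G = ∀ {S T} → S ∈ᶠ F → T ∈ᶠ G → Nonempty (S ∩ T)

shift : (U V : Subset n) → Subset n → Subset n
shift U V F with (F ∩ (U ∪ V)) ≟ˢ V
... | yes _ = (F ─ V) ∪ U
... | no  _ = F

shiftFamily : (U V : Subset n) → Family n → Family n
shiftFamily U V F = record
  { Member  = λ T → (∃ λ S → S ∈ᶠ F × T ≡ shift U V S) ⊎ (T ∈ᶠ F × shift U V T ∈ᶠ F)
  ; member? = λ T → anySubset? (λ S → member? F S ×-dec (T ≟ˢ shift U V S))
                    ⊎-dec (member? F T ×-dec member? F (shift U V T))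
  }

lexSum : Family n → ℕ
lexSum {n} F = sum (map iLex (filter (member? F) (subsets n)))

record PropertyQ (U V : Subset n) (F : Family n) : Set where
  field
    disjoint  : Empty (U ∩ V)
    sameSize  : ∣ U ∣ ≡ ∣ V ∣
    precedes  : U ≺ V
    decreases : lexSum (shiftFamily U V F) <ℕ lexSum F
    stable    : ∀ V′ → V′ ⊂ V →
                ∃ λ U′ → U′ ⊂ U × U′ ≺ V′ × ∣ U′ ∣ ≡ ∣ V′ ∣ × shiftFamily U′ V′ F ≈ᶠ F

PropertyQ₂ : (U V : Subset n) → Family n → Family n → Set
PropertyQ₂ U V A B = PropertyQ U V A ⊎ PropertyQ U V B

{-# OPTIONS --safe #-}

-- Let S = (S₀ ∖ V) ∪ U be new in one shifted family and T an old member of the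
-- other that misses U.  If V ⊆ T, then T was kept because (T ∖ V) ∪ U is also a
-- member, and S₀ meets that set outside U ∪ V.  Otherwise V′ = V ∩ T is a proper
-- subset of V; stability under the shift (U′ , V′) replaces V′ by U′ in S₀ or in T,
-- whichever lies in the stable family, and the resulting pair can only meet
-- inside S ∩ T.

module Submission where

open import Defs
open import Data.Nat using (ℕ; _+_; _≥_)
open import Data.Fin.Subset using (Subset; inside; outside; _∈_; _∉_; _⊆_; _⊂_; _∩_; _∪_; _─_; ∣_∣; Empty; Nonempty)
open import Data.Fin.Subset.Properties
open import Data.Nat.Properties using (m<n⇒n≢0)
open import Data.Product using (∃; _×_; _,_; proj₁; proj₂)
open import Data.Sum using (_⊎_; inj₁; inj₂; swap)
open import Data.Vec using (_∷_; here; there)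
open import Relation.Binary.PropositionalEquality using (_≡_; refl; sym; trans; cong; subst)
open import Relation.Nullary using (yes; no; contradiction)

private
  variable
    n : ℕ
    U V S T : Subset n

x∈p─q⇒x∉q : ∀ (p q : Subset n) {x} → x ∈ p ─ q → x ∉ q
x∈p─q⇒x∉q (inside ∷ p) (outside ∷ q) here       ()
x∈p─q⇒x∉q (_      ∷ p) (_       ∷ q) (there x∈) (there x∈q) = x∈p─q⇒x∉q p q x∈ x∈q

Nonempty-∩-comm : ∀ (p q : Subset n) → Nonempty (p ∩ q) → Nonempty (q ∩ p)
Nonempty-∩-comm p q = subst Nonempty (∩-comm p q)

∣p∣≡∣q∣⇒Nonempty : ∀ (p q : Subset n) → ∣ p ∣ ≡ ∣ q ∣ → Nonempty q → Nonempty p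
∣p∣≡∣q∣⇒Nonempty {n} p q eq (x , x∈q) with nonempty? p
... | yes ne    = ne
... | no  empty = contradiction
  (trans (sym eq) (trans (cong ∣_∣ (Empty-unique empty)) (∣⊥∣≡0 n)))
  (m<n⇒n≢0 (x∈p⇒∣p-x∣<∣p∣ x∈q))

-- For disjoint `U` and `V` this amounts to `V ⊆ S` together with `S` missing `U`; the next three
-- lemmas pass between the two forms.
Movable : (U V S : Subset n) → Set
Movable U V S = S ∩ (U ∪ V) ≡ V

exchange : (U V S : Subset n) → Subset n
exchange U V S = (S ─ V) ∪ U

movable⁺ : V ⊆ S → Empty (U ∩ S) → Movable U V S
movable⁺ {V = V} {S = S} {U = U} V⊆S U∩S=∅ = ⊆-antisym to from
  where
  to : S ∩ (U ∪ V) ⊆ V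
  to x∈ with x∈p∩q⁻ S (U ∪ V) x∈
  ... | x∈S , x∈U∪V with x∈p∪q⁻ U V x∈U∪V
  ...   | inj₁ x∈U = contradiction (_ , x∈p∩q⁺ (x∈U , x∈S)) U∩S=∅
  ...   | inj₂ x∈V = x∈V
  from : V ⊆ S ∩ (U ∪ V)
  from x∈V = x∈p∩q⁺ (V⊆S x∈V , x∈p∪q⁺ (inj₂ x∈V))

movable⇒⊆ : Movable U V S → V ⊆ S
movable⇒⊆ {U = U} {S = S} eq {x} x∈V =
  proj₁ (x∈p∩q⁻ S (U ∪ _) (subst (x ∈_) (sym eq) x∈V))

movable⇒disjoint : Empty (U ∩ V) → Movable U V S → Empty (U ∩ S)
movable⇒disjoint {U = U} {S = S} U∩V=∅ eq (x , x∈) with x∈p∩q⁻ U S x∈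
... | x∈U , x∈S =
  U∩V=∅ (x , x∈p∩q⁺ (x∈U , subst (x ∈_) eq (x∈p∩q⁺ (x∈S , x∈p∪q⁺ (inj₁ x∈U)))))

∈-exchange⁻ : ∀ (U V S : Subset n) {x} → x ∈ exchange U V S → (x ∈ S × x ∉ V) ⊎ x ∈ U
∈-exchange⁻ U V S x∈ with x∈p∪q⁻ (S ─ V) U x∈
... | inj₁ x∈S─V = inj₁ (p─q⊆p S V x∈S─V , x∈p─q⇒x∉q S V x∈S─V)
... | inj₂ x∈U   = inj₂ x∈U

∈-exchange⁺ : ∀ {x} → (x ∈ S × x ∉ V) ⊎ x ∈ U → x ∈ exchange U V S
∈-exchange⁺ (inj₁ (x∈S , x∉V)) = x∈p∪q⁺ (inj₁ (x∈p∧x∉q⇒x∈p─q x∈S x∉V))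
∈-exchange⁺ (inj₂ x∈U)         = x∈p∪q⁺ (inj₂ x∈U)

shift-movable : Movable U V S → shift U V S ≡ exchange U V S
shift-movable {U = U} {V = V} {S = S} mv with (S ∩ (U ∪ V)) ≟ˢ V
... | yes _  = refl
... | no ¬mv = contradiction mv ¬mv

Moved : (U V : Subset n) → Family n → Subset n → Set
Moved U V F T = ∃ λ S → S ∈ᶠ F × Movable U V S × T ≡ exchange U V S

-- The condition on the exchanged set is guarded by `Movable`, so that members fixed by the shift
-- fall under this case as well and `Moved` covers only sets that satisfy the shift condition.
Kept : (U V : Subset n) → Family n → Subset n → Set
Kept U V F T = T ∈ᶠ F × (Movable U V T → exchange U V T ∈ᶠ F)

∈-shiftFamily⁻ : ∀ (U V : Subset n) F {T} →
                 T ∈ᶠ shiftFamily U V F → Moved U V F T ⊎ Kept U V F T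
∈-shiftFamily⁻ U V F (inj₁ (S , S∈F , eq)) with (S ∩ (U ∪ V)) ≟ˢ V
... | yes mv = inj₁ (S , S∈F , mv , eq)
-- The image of a fixed set is the set itself: it counts as kept, with a vacuous guard.
... | no ¬mv with refl ← eq = inj₂ (S∈F , λ mv → contradiction mv ¬mv)
∈-shiftFamily⁻ U V F (inj₂ (T∈F , T′∈F)) =
  inj₂ (T∈F , λ mv → subst (_∈ᶠ F) (shift-movable mv) T′∈F)

-- The fixed-family clause of `PropertyQ`, recast as closure of the family under exchanging `V′` for
-- `U′`.
Stable : (U V : Subset n) → Family n → Set
Stable U V F = ∀ V′ → V′ ⊂ V → ∃ λ U′ → U′ ⊆ U ×
  (∀ {S} → S ∈ᶠ F → Movable U′ V′ S → exchange U′ V′ S ∈ᶠ F)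

propertyQ⇒stable : ∀ F → PropertyQ U V F → Stable U V F
propertyQ⇒stable F Q V′ V′⊂V with PropertyQ.stable Q V′ V′⊂V
... | U′ , U′⊂U , _ , _ , fixed = U′ , proj₁ U′⊂U , λ {S} S∈F mv →
  proj₁ fixed (inj₁ (S , S∈F , sym (shift-movable mv)))

-- The original sets share a point. Outside `V` it survives both exchanges; inside `V` it shows that
-- `V`, and by equal size `U`, is nonempty, and both new sets contain `U`.
moved-moved : ∀ A B → CrossIntersecting A B → ∣ U ∣ ≡ ∣ V ∣ →
              Moved U V A S → Moved U V B T → Nonempty (S ∩ T)
moved-moved {U = U} {V = V} A B cross ∣U∣≡∣V∣ (S , S∈A , _ , refl) (T , T∈B , _ , refl)
  with x , x∈ ← cross S∈A T∈B
  with x∈S , x∈T ← x∈p∩q⁻ S T x∈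
  with x ∈? V
... | no x∉V  = x , x∈p∩q⁺ (∈-exchange⁺ (inj₁ (x∈S , x∉V)) , ∈-exchange⁺ (inj₁ (x∈T , x∉V)))
... | yes x∈V with y , y∈U ← ∣p∣≡∣q∣⇒Nonempty U V ∣U∣≡∣V∣ (x , x∈V) =
  y , x∈p∩q⁺ (∈-exchange⁺ (inj₂ y∈U) , ∈-exchange⁺ (inj₂ y∈U))

moved-kept : Empty (U ∩ V) → ∀ A B → CrossIntersecting A B → Stable U V A ⊎ Stable U V B →
             Moved U V A S → Kept U V B T → Nonempty (S ∩ T)
moved-kept {U = U} {V = V} {T = T} U∩V=∅ A B cross stable (S , S∈A , mv , refl) (T∈B , T′∈B)
  with nonempty? (U ∩ T)
... | yes (x , x∈) with x∈U , x∈T ← x∈p∩q⁻ U T x∈ =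
  x , x∈p∩q⁺ (∈-exchange⁺ (inj₂ x∈U) , x∈T)
... | no U∩T=∅ = conclude
  where
  U∩S=∅ : Empty (U ∩ S)
  U∩S=∅ = movable⇒disjoint U∩V=∅ mv

  V⊆S : V ⊆ S
  V⊆S = movable⇒⊆ {U = U} mv

  -- Serves every exchange made in `T`, with `W` either `V ∩ T` or `V`. The common point cannot come
  -- from `U′`, since `S` misses `U`; so it lies in `T` outside `W`, hence outside `V`, and survives
  -- in `exchange U V S`.
  meet : ∀ U′ W → U′ ⊆ U → (∀ {x} → x ∈ T → x ∉ W → x ∉ V) →
         Nonempty (S ∩ exchange U′ W T) → Nonempty (exchange U V S ∩ T)
  meet U′ W U′⊆U V∩T⊆W (x , x∈) with x∈p∩q⁻ S _ x∈
  ... | x∈S , x∈T′ with ∈-exchange⁻ U′ W T x∈T′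
  ...   | inj₁ (x∈T , x∉W) = x , x∈p∩q⁺ (∈-exchange⁺ (inj₁ (x∈S , V∩T⊆W x∈T x∉W)) , x∈T)
  ...   | inj₂ x∈U′ = contradiction (x , x∈p∩q⁺ (U′⊆U x∈U′ , x∈S)) U∩S=∅

  disjoint-⊆ : ∀ {U′ R} → U′ ⊆ U → Empty (U ∩ R) → Empty (U′ ∩ R)
  disjoint-⊆ {U′} {R} U′⊆U U∩R=∅ (x , x∈) with x∈U′ , x∈R ← x∈p∩q⁻ U′ R x∈ =
    U∩R=∅ (x , x∈p∩q⁺ (U′⊆U x∈U′ , x∈R))

  outside-V∩T : ∀ {x} → x ∈ T → x ∉ V ∩ T → x ∉ V
  outside-V∩T x∈T x∉V∩T x∈V = x∉V∩T (x∈p∩q⁺ (x∈V , x∈T))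

  V∩T⊂V : Nonempty (V ─ T) → V ∩ T ⊂ V
  V∩T⊂V (x , x∈) = p∩q⊆p V T , x , p─q⊆p V T x∈ ,
    λ x∈V∩T → x∈p─q⇒x∉q V T x∈ (p∩q⊆q V T x∈V∩T)

  V⊆T : Empty (V ─ T) → V ⊆ T
  V⊆T V─T=∅ {x} x∈V with x ∈? T
  ... | yes x∈T = x∈T
  ... | no  x∉T = contradiction (x , x∈p∧x∉q⇒x∈p─q x∈V x∉T) V─T=∅

  by-stability : Nonempty (V ─ T) → Stable U V A ⊎ Stable U V B →
                 Nonempty (exchange U V S ∩ T)
  by-stability ne (inj₂ stableB) with U′ , U′⊆U , closed ← stableB (V ∩ T) (V∩T⊂V ne) =
    meet U′ (V ∩ T) U′⊆U outside-V∩T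
      (cross S∈A (closed T∈B (movable⁺ (p∩q⊆q V T) (disjoint-⊆ U′⊆U U∩T=∅))))
  -- Now `S` is exchanged instead. A point of `T` retained from `S` avoids `V ∩ T` and hence `V`; a
  -- point of `U′` lies in `U`, which the fully exchanged set contains.
  by-stability ne (inj₁ stableA)
    with U′ , U′⊆U , closed ← stableA (V ∩ T) (V∩T⊂V ne)
    with x , x∈ ← cross (closed S∈A (movable⁺ (λ x∈ → V⊆S (p∩q⊆p V T x∈)) (disjoint-⊆ U′⊆U U∩S=∅))) T∈B
    with x∈S′ , x∈T ← x∈p∩q⁻ _ T x∈
    with ∈-exchange⁻ U′ (V ∩ T) S x∈S′
  ... | inj₁ (x∈S , x∉V∩T) = x , x∈p∩q⁺ (∈-exchange⁺ (inj₁ (x∈S , outside-V∩T x∈T x∉V∩T)) , x∈T)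
  ... | inj₂ x∈U′ = x , x∈p∩q⁺ (∈-exchange⁺ (inj₂ (U′⊆U x∈U′)) , x∈T)

  conclude : Nonempty (exchange U V S ∩ T)
  conclude with nonempty? (V ─ T)
  ... | yes ne   = by-stability ne stable
  -- Here `T` itself is movable, so the guard in `Kept` is met and its exchange lies in `B`.
  ... | no V─T=∅ = meet U V (λ x∈U → x∈U) (λ _ x∉V → x∉V)
    (cross S∈A (T′∈B (movable⁺ (V⊆T V─T=∅) U∩T=∅)))

shift-crossIntersecting : ∀ A B → Empty (U ∩ V) → ∣ U ∣ ≡ ∣ V ∣ →
  Stable U V A ⊎ Stable U V B → CrossIntersecting A B →
  CrossIntersecting (shiftFamily U V A) (shiftFamily U V B)
shift-crossIntersecting {U = U} {V = V} A B U∩V=∅ ∣U∣≡∣V∣ stable cross {S} {T} S∈ T∈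
  with ∈-shiftFamily⁻ U V A S∈ | ∈-shiftFamily⁻ U V B T∈
... | inj₁ S-moved   | inj₁ T-moved   = moved-moved A B cross ∣U∣≡∣V∣ S-moved T-moved
... | inj₁ S-moved   | inj₂ T-kept    = moved-kept U∩V=∅ A B cross stable S-moved T-kept
... | inj₂ (S∈A , _) | inj₂ (T∈B , _) = cross S∈A T∈B
-- The mirror case: exchanging the roles of the families also swaps which of them is stable.
... | inj₂ S-kept    | inj₁ T-moved   = Nonempty-∩-comm T S
  (moved-kept U∩V=∅ B A (λ {P} {R} P∈B R∈A → Nonempty-∩-comm R P (cross R∈A P∈B))
    (swap stable) T-moved S-kept)

lemma9p1 : (n a b : ℕ) → n ≥ a + b →
    (A B : Family n) → Uniform a A → Uniform b B →
    CrossIntersecting A B →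
    (U V : Subset n) → PropertyQ₂ U V A B →
    CrossIntersecting (shiftFamily U V A) (shiftFamily U V B)
lemma9p1 n a b _ A B _ _ cross U V (inj₁ Q) =
  shift-crossIntersecting A B disjoint sameSize (inj₁ (propertyQ⇒stable A Q)) cross
  where open PropertyQ Q
lemma9p1 n a b _ A B _ _ cross U V (inj₂ Q) =
  shift-crossIntersecting A B disjoint sameSize (inj₂ (propertyQ⇒stable B Q)) cross
  where open PropertyQ Q
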